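{- There exists a constant $C>0$ such that for every sufficiently large $n$ and any two $n$-vertex $3$-uniform generalised hedgehogs $H,H'$ we have \[R(H,H')\le C n^{3/2}.\]
   Context: A $3$-graph is a $3$-uniform hypergraph. For $3$-graphs $G,H$, the ($2$-colour) Ramsey number $R(G,H)$ is the least $N$ such that every colouring of the edges of the complete $3$-graph on $N$ vertices with red and blue contains a blue copy of $G$ or a red copy of $H$. A (generalised) hedgehog is a $3$-graph on vertex set $B\sqcup S$ ($B$ the body, $S$ the spikes) in which every edge consists of one spike and two body vertices, and every spike lies in exactly one edge (different spikes may be attached to the same pair of body vertices, and some pairs of body vertices may have no spike). -}

module Defs where

open import Data.Fin using (Fin)
open import Data.Fin.Properties using (any?) renaming (_≟_ to _≟ᶠ_)
open import Data.Fin.Subset using (Subset; _∈_; _∩_; ∁; ∣_∣)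
open import Data.Fin.Subset.Properties using (_∈?_)
open import Data.Nat using (ℕ; _<_)
open import Data.Nat.Properties using (≡-irrelevant) renaming (_≟_ to _≟ⁿ_)
open import Data.Product using (Σ; ∃; ∃!; _×_; _,_)
open import Data.Sum using (_⊎_)
open import Data.Vec using (tabulate)
open import Function.Definitions using (Injective)
open import Relation.Binary.Definitions using (DecidableEquality)
open import Relation.Binary.PropositionalEquality using (_≡_; refl; subst)
open import Relation.Nullary using (¬_; yes; no; does)
open import Relation.Nullary.Decidable using (_×-dec_)
open import Relation.Unary using (Decidable)

-- Decidability of Edge makes the edge set a genuine finite set of triples.
record 3-Graph (n : ℕ) : Set₁ where
  field
    Edge    : Subset n → Set
    edge?   : Decidable Edge
    uniform : ∀ {e} → Edge e → ∣ e ∣ ≡ 3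

open 3-Graph public

complete : (N : ℕ) → 3-Graph N
complete N .Edge e    = ∣ e ∣ ≡ 3
complete N .edge? e   = ∣ e ∣ ≟ⁿ 3
complete N .uniform p = p

image : ∀ {n N} → (Fin n → Fin N) → Subset n → Subset N
image f e = tabulate λ j → does (any? λ i → (i ∈? e) ×-dec (f i ≟ᶠ j))

-- Copies need not be induced.
ContainsCopy : ∀ {n N} → 3-Graph N → 3-Graph n → Set
ContainsCopy {n} {N} K G =
  Σ (Fin n → Fin N) λ f →
    Injective _≡_ _≡_ f × (∀ e → Edge G e → Edge K (image f e))

data Colour : Set where
  red blue : Colour

_≟ᶜ_ : DecidableEquality Colour
red  ≟ᶜ red  = yes refl
red  ≟ᶜ blue = no λ ()
blue ≟ᶜ red  = no λ ()
blue ≟ᶜ blue = yes refl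

-- The edge proof is an equality in ℕ, hence unique, so each edge of the
-- complete 3-graph receives exactly one colour.
Colouring : ℕ → Set
Colouring N = (e : Subset N) → Edge (complete N) e → Colour

colourClass : ∀ {N} → Colouring N → Colour → 3-Graph N
colourClass {N} χ c .Edge e = Σ (Edge (complete N) e) λ p → χ e p ≡ c
colourClass {N} χ c .edge? e with edge? (complete N) e
... | no ¬p = no λ (p , _) → ¬p p
... | yes p with χ e p ≟ᶜ c
...   | yes q = yes (p , q)
...   | no ¬q = no λ (p′ , q) → ¬q (subst (λ r → χ e r ≡ c) (≡-irrelevant p′ p) q)
colourClass χ c .uniform (p , _) = p

Arrows : ∀ {m n} → ℕ → 3-Graph m → 3-Graph n → Set
Arrows N G H = (χ : Colouring N) →
  ContainsCopy (colourClass χ blue) G ⊎ ContainsCopy (colourClass χ red) H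

-- R(G,H) as a relation: R is the least N with the Ramsey property.
IsRamseyNumber : ∀ {m n} → 3-Graph m → 3-Graph n → ℕ → Set
IsRamseyNumber G H R = Arrows R G H × (∀ N → N < R → ¬ Arrows N G H)

-- The set of spikes is the complement of the body.
record IsHedgehogWithBody {n : ℕ} (G : 3-Graph n) (body : Subset n) : Set where
  field
    one-spike   : ∀ e → Edge G e → ∣ e ∩ ∁ body ∣ ≡ 1
    two-body    : ∀ e → Edge G e → ∣ e ∩ body ∣ ≡ 2
    unique-edge : ∀ s → s ∈ ∁ body → ∃! _≡_ λ e → Edge G e × s ∈ e

IsHedgehog : ∀ {n} → 3-Graph n → Set
IsHedgehog G = ∃ λ body → IsHedgehogWithBody G body

{-# OPTIONS --safe #-}
module Submission where

-- Call a pair of vertices poor in a colour if at most 2n triples of that colour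
-- contain it.  A pair of body vertices mapped to a pair that is not poor always
-- has room for its spikes, so it suffices to embed the body graph, which has at
-- most n edges, avoiding poor pairs.
--
-- If u has b blue-poor and r red-poor partners, each of the b * r triples formed
-- by u and one partner of each kind is blue or red, whence b * r is at most about
-- 2n (b + r), and so b or r is O(n).  Hence in one colour half of the vertices
-- have O(n) poor partners.  Embed the body greedily into these, the vertices of
-- degree more than s ≈ 2√n first: each vertex then has at most s neighbours
-- before it, which rule out O(n s) places, so a pool of O(n^(3/2)) is enough.

open import Data.Bool using (true; if_then_else_)
open import Data.Empty using (⊥)
open import Data.Fin using (Fin; zero; suc)
open import Data.Fin.Properties using (any?; all?; suc-injective) renaming (_≟_ to _≟ᶠ_)
open import Data.Fin.Subset using (Subset; _∈_; _∉_; _∩_; _∪_; ∁; ∣_∣; ⁅_⁆; inside; outside)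
open import Data.Fin.Subset.Properties using (_∈?_; anySubset?; x∈⁅x⁆; x∈⁅y⁆⇒x≡y; ∣⁅x⁆∣≡1; x∈p∪q⁺; x∈p∪q⁻; x∈p∩q⁺; x∈p∩q⁻; x∈∁p⇒x∉p; x∉p⇒x∈∁p; ∪-assoc; ∪-comm; ∪-identityˡ; ⊆-antisym)
open import Data.List using (List; []; _∷_; _++_; filter; allFin)
open import Data.List.Membership.Propositional.Properties using (∈-allFin; ∈-filter⁺; ∈-filter⁻; ∈-++⁺ˡ; ∈-++⁺ʳ)
open import Data.List.Relation.Unary.Any using (here; there)
open import Data.Nat using (ℕ; zero; suc; pred; _+_; _*_; _^_; _≤_; _<_; _≤?_; _<?_; z≤n; s≤s; NonZero; >-nonZero)
open import Data.Nat.Properties hiding (suc-injective)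
open import Data.Nat.Solver using (module +-*-Solver)
open import Data.Product using (∃; ∃₂; ∃-syntax; _×_; _,_; proj₁; proj₂)
open import Data.Sum as Sum using (_⊎_; inj₁; inj₂; [_,_]′)
open import Data.Unit using (⊤; tt)
open import Data.Vec using (Vec; []; _∷_; here; there; lookup; tabulate)
open import Data.Vec.Properties using (lookup∘tabulate; lookup⇒[]=; []=⇒lookup)
open import Data.Vec.Functional using (updateAt)
open import Data.Vec.Functional.Properties using (updateAt-updates; updateAt-minimal)
open import Function using (_∘_; const; id)
open import Relation.Binary.PropositionalEquality using (_≡_; _≢_; refl; sym; trans; cong; cong₂; subst; module ≡-Reasoning)
open import Relation.Nullary using (¬_; Dec; yes; no; does; contradiction)
open import Relation.Nullary.Decidable using (_×-dec_; _⊎-dec_; _→-dec_; ¬?; map′; toSum; dec-true; dec-false; decidable-stable)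
open import Relation.Unary using (Pred; Decidable)
open import Defs
import Data.List.Membership.DecPropositional as DecMembership
open module FinMembership {n} = DecMembership (_≟ᶠ_ {n}) using () renaming (_∈_ to _∈ˡ_; _∉_ to _∉ˡ_; _∈?_ to _∈ˡ?_)

open import Algebra.Properties.Semiring.Sum +-*-semiring using (sum; sum-cong-≗; ∑-distrib-+; ∑-comm; *-distribˡ-sum; *-distribʳ-sum)

-- Counting in Fin n

sum-mono : ∀ {n} {f g : Fin n → ℕ} → (∀ i → f i ≤ g i) → sum f ≤ sum g
sum-mono {zero}  f≤g = z≤n
sum-mono {suc n} f≤g = +-mono-≤ (f≤g zero) (sum-mono (f≤g ∘ suc))

sum-const : ∀ n c → sum {n} (const c) ≡ n * c
sum-const zero    c = refl
sum-const (suc n) c = cong (c +_) (sum-const n c)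

term≤sum : ∀ {n} (f : Fin n → ℕ) i → f i ≤ sum f
term≤sum f zero    = m≤m+n _ _
term≤sum f (suc i) = ≤-trans (term≤sum (f ∘ suc) i) (m≤n+m _ _)

𝟙 : ∀ {A : Set} → Dec A → ℕ
𝟙 a? = if does a? then 1 else 0

𝟙≤1 : ∀ {A : Set} (a? : Dec A) → 𝟙 a? ≤ 1
𝟙≤1 (yes _) = ≤-refl
𝟙≤1 (no _)  = z≤n

𝟙-intro : ∀ {A : Set} (a? : Dec A) → A → 1 ≤ 𝟙 a?
𝟙-intro (yes _) _ = ≤-refl
𝟙-intro (no ¬a) a = contradiction a ¬a

𝟙-elim : ∀ {A : Set} {m} (a? : Dec A) → (A → 1 ≤ m) → 𝟙 a? ≤ m
𝟙-elim (yes a) h = h a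
𝟙-elim (no _)  _ = z≤n

𝟙-*-monoʳ : ∀ {A : Set} {m k} (a? : Dec A) → (A → m ≤ k) → 𝟙 a? * m ≤ 𝟙 a? * k
𝟙-*-monoʳ (yes a) h = *-monoʳ-≤ 1 (h a)
𝟙-*-monoʳ (no _)  _ = z≤n

#_ : ∀ {n} {P : Pred (Fin n) _} → Decidable P → ℕ
# P? = sum (𝟙 ∘ P?)

#≤n : ∀ {n} {P : Pred (Fin n) _} (P? : Decidable P) → # P? ≤ n
#≤n {n} P? = ≤-trans (sum-mono (𝟙≤1 ∘ P?)) (≤-reflexive (trans (sum-const n 1) (*-identityʳ n)))

#-mono : ∀ {n} {P Q : Pred (Fin n) _} (P? : Decidable P) (Q? : Decidable Q) →
         (∀ i → P i → Q i) → # P? ≤ # Q?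
#-mono P? Q? P⊆Q = sum-mono λ i → 𝟙-elim (P? i) (𝟙-intro (Q? i) ∘ P⊆Q i)

#-∪ : ∀ {n} {P Q : Pred (Fin n) _} (P? : Decidable P) (Q? : Decidable Q) →
      # (λ i → P? i ⊎-dec Q? i) ≤ # P? + # Q?
#-∪ P? Q? = ≤-trans
  (sum-mono λ i → 𝟙-elim (P? i ⊎-dec Q? i)
    [ (λ p → ≤-trans (𝟙-intro (P? i) p) (m≤m+n _ _))
    , (λ q → ≤-trans (𝟙-intro (Q? i) q) (m≤n+m _ _)) ]′)
  (≤-reflexive (∑-distrib-+ (𝟙 ∘ P?) (𝟙 ∘ Q?)))

#≡0 : ∀ {n} {P : Pred (Fin n) _} (P? : Decidable P) → (∀ i → ¬ P i) → # P? ≤ 0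
#≡0 {n} P? ¬P = ≤-trans (sum-mono λ i → 𝟙-elim (P? i) λ p → contradiction p (¬P i))
                        (≤-reflexive (trans (sum-const n 0) (*-zeroʳ n)))

#-unique : ∀ {n} {P : Pred (Fin n) _} (P? : Decidable P) →
           (∀ i j → P i → P j → i ≡ j) → # P? ≤ 1
#-unique {zero}  P? uniq = z≤n
#-unique {suc n} P? uniq with P? zero
... | yes p₀ = s≤s (#≡0 (P? ∘ suc) λ i pᵢ → contradiction (uniq zero (suc i) p₀ pᵢ) λ ())
... | no _   = #-unique (P? ∘ suc) λ i j pᵢ pⱼ → suc-injective (uniq (suc i) (suc j) pᵢ pⱼ)

#-≡ : ∀ {n} (c : Fin n) → # (c ≟ᶠ_) ≤ 1
#-≡ c = #-unique (c ≟ᶠ_) λ i j c≡i c≡j → trans (sym c≡i) c≡j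

-- Pigeonhole behind every greedy choice below: `P` collects the forbidden places, `Q` the
-- admissible ones.
#<#⇒∃ : ∀ {n} {P Q : Pred (Fin n) _} (P? : Decidable P) (Q? : Decidable Q) →
        # P? < # Q? → ∃ λ i → Q i × ¬ P i
#<#⇒∃ P? Q? p<q with any? (λ i → Q? i ×-dec ¬? (P? i))
... | yes found = found
... | no none   = contradiction p<q (≤⇒≯ (#-mono Q? P? λ i q →
                    decidable-stable (P? i) λ ¬p → none (i , q , ¬p)))

#-⋃ : ∀ {m n K} {A : Pred (Fin m) _} (A? : Decidable A)
      {Q : Fin m → Pred (Fin n) _} (Q? : ∀ i → Decidable (Q i)) →
      (∀ i → A i → # (Q? i) ≤ K) →
      # (λ j → any? λ i → A? i ×-dec Q? i j) ≤ # A? * K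
#-⋃ {m} {n} {K} A? Q? small = begin
  # (λ j → any? λ i → A? i ×-dec Q? i j)
    -- Union bound: a member `j` of the union is witnessed by some `i`, and its term alone
    -- contributes 1 to the inner sum. Exchanging the sums leaves one count of `Q i` for each `i` in
    -- `A`.
    ≤⟨ sum-mono (λ j → 𝟙-elim (any? λ i → A? i ×-dec Q? i j) λ (i , a , q) →
         ≤-trans (*-mono-≤ (𝟙-intro (A? i) a) (𝟙-intro (Q? i j) q))
                 (term≤sum (λ i → 𝟙 (A? i) * 𝟙 (Q? i j)) i)) ⟩
  sum (λ j → sum λ i → 𝟙 (A? i) * 𝟙 (Q? i j))
    ≡⟨ ∑-comm (λ j i → 𝟙 (A? i) * 𝟙 (Q? i j)) ⟩
  sum (λ i → sum λ j → 𝟙 (A? i) * 𝟙 (Q? i j))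
    ≡⟨ sum-cong-≗ (λ i → *-distribˡ-sum (𝟙 (A? i)) (𝟙 ∘ Q? i)) ⟨
  sum (λ i → 𝟙 (A? i) * # (Q? i))
    ≤⟨ sum-mono (λ i → 𝟙-*-monoʳ (A? i) (small i)) ⟩
  sum (λ i → 𝟙 (A? i) * K)
    ≡⟨ *-distribʳ-sum K (𝟙 ∘ A?) ⟨
  # A? * K ∎
  where open ≤-Reasoning

-- Each cell of the grid `P` by `Q` is charged to its row if `α` holds there and to its column if
-- `γ` does; a row or a column receives at most `k` charges.
double-count : ∀ {m n k} {P : Pred (Fin m) _} {Q : Pred (Fin n) _} {α γ : Fin m → Fin n → Set}
  (P? : Decidable P) (Q? : Decidable Q)
  (α? : ∀ v w → Dec (α v w)) (γ? : ∀ v w → Dec (γ v w)) →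
  (∀ v → P v → # (α? v) ≤ k) → (∀ w → Q w → # (λ v → γ? v w) ≤ k) →
  (∀ v w → P v → Q w → α v w ⊎ γ v w) →
  # P? * # Q? ≤ # P? * k + # Q? * k
double-count {m} {n} {k} P? Q? α? γ? rows cols cover = begin
  # P? * # Q?
    ≡⟨ *-distribʳ-sum (# Q?) (𝟙 ∘ P?) ⟩
  sum (λ v → 𝟙 (P? v) * # Q?)
    ≡⟨ sum-cong-≗ (λ v → *-distribˡ-sum (𝟙 (P? v)) (𝟙 ∘ Q?)) ⟩
  sum (λ v → sum λ w → 𝟙 (P? v) * 𝟙 (Q? w))
    ≤⟨ sum-mono (λ v → sum-mono λ w → cell v w) ⟩
  sum (λ v → sum λ w → 𝟙 (P? v) * 𝟙 (α? v w) + 𝟙 (Q? w) * 𝟙 (γ? v w))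
    ≡⟨ sum-cong-≗ (λ v → ∑-distrib-+ (λ w → 𝟙 (P? v) * 𝟙 (α? v w)) _) ⟩
  sum (λ v → sum (λ w → 𝟙 (P? v) * 𝟙 (α? v w)) + sum (λ w → 𝟙 (Q? w) * 𝟙 (γ? v w)))
    ≡⟨ ∑-distrib-+ (λ v → sum (λ w → 𝟙 (P? v) * 𝟙 (α? v w))) _ ⟩
  sum (λ v → sum (λ w → 𝟙 (P? v) * 𝟙 (α? v w))) + sum (λ v → sum (λ w → 𝟙 (Q? w) * 𝟙 (γ? v w)))
    ≡⟨ cong₂ _+_
         (sum-cong-≗ (λ v → sym (*-distribˡ-sum (𝟙 (P? v)) (𝟙 ∘ α? v))))
         (trans (∑-comm (λ v w → 𝟙 (Q? w) * 𝟙 (γ? v w)))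
                (sum-cong-≗ (λ w → sym (*-distribˡ-sum (𝟙 (Q? w)) (λ v → 𝟙 (γ? v w)))))) ⟩
  sum (λ v → 𝟙 (P? v) * # (α? v)) + sum (λ w → 𝟙 (Q? w) * # (λ v → γ? v w))
    ≤⟨ +-mono-≤ (sum-mono λ v → 𝟙-*-monoʳ (P? v) (rows v))
                (sum-mono λ w → 𝟙-*-monoʳ (Q? w) (cols w)) ⟩
  sum (λ v → 𝟙 (P? v) * k) + sum (λ w → 𝟙 (Q? w) * k)
    ≡⟨ cong₂ _+_ (*-distribʳ-sum k (𝟙 ∘ P?)) (*-distribʳ-sum k (𝟙 ∘ Q?)) ⟨
  # P? * k + # Q? * k ∎
  where
  open ≤-Reasoning
  cell : ∀ v w → 𝟙 (P? v) * 𝟙 (Q? w) ≤ 𝟙 (P? v) * 𝟙 (α? v w) + 𝟙 (Q? w) * 𝟙 (γ? v w)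
  cell v w with P? v | Q? w
  ... | no _  | _     = z≤n
  ... | yes _ | no _  = z≤n
  ... | yes p | yes q with cover v w p q
  ...   | inj₁ a = ≤-trans (𝟙-intro (α? v w) a)
                     (≤-trans (m≤m+n _ 0) (m≤m+n _ _))
  ...   | inj₂ c = ≤-trans (𝟙-intro (γ? v w) c)
                     (≤-trans (m≤m+n _ 0) (m≤n+m _ (𝟙 (α? v w) + 0)))

-- If both factors exceeded `2 * k`, the doubled right side `a * (2 * k) + 2 * k * b` would be less
-- than `a * b + a * b`.
product≤⇒small : ∀ a b k → a * b ≤ a * k + b * k → a ≤ 2 * k ⊎ b ≤ 2 * k
product≤⇒small a b k ab≤ with a ≤? 2 * k | b ≤? 2 * k
... | yes a≤ | _      = inj₁ a≤
... | no _   | yes b≤ = inj₂ b≤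
... | no a≰  | no b≰  = contradiction (+-mono-≤ ab≤ ab≤) (<⇒≱ (begin-strict
  (a * k + b * k) + (a * k + b * k) ≡⟨ solve 3 (λ a b k → (a :* k :+ b :* k) :+ (a :* k :+ b :* k)
                                         := a :* (con 2 :* k) :+ (con 2 :* k) :* b) refl a b k ⟩
  a * (2 * k) + 2 * k * b           ≤⟨ +-monoˡ-≤ (2 * k * b) (*-monoʳ-≤ a (<⇒≤ (≰⇒> b≰))) ⟩
  a * b + 2 * k * b                 <⟨ +-monoʳ-< (a * b) (*-monoˡ-< b (≰⇒> a≰)) ⟩
  a * b + a * b                     ∎))
  where
  open ≤-Reasoning
  open +-*-Solver
  instance
    b≢0 : NonZero b
    b≢0 = >-nonZero (≤-<-trans z≤n (≰⇒> b≰))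

-- Greedy embedding

∈-shrink : ∀ {n} {x y : Fin n} {xs} → x ∈ˡ xs → y ∈ˡ x ∷ xs → y ∈ˡ xs
∈-shrink x∈ (here refl) = x∈
∈-shrink x∈ (there y∈)  = y∈

Adjacent : ∀ {n} → (p q : Fin n → Fin n) → Fin n → Fin n → Set
Adjacent p q x y = ∃ λ e → (p e ≡ x × q e ≡ y) ⊎ (p e ≡ y × q e ≡ x)

Adjacent-sym : ∀ {n} (p q : Fin n → Fin n) {x y} → Adjacent p q x y → Adjacent p q y x
Adjacent-sym p q (e , ends) = e , [ inj₂ , inj₁ ]′ ends

-- The graph to embed is given by its edges e : Fin n, which join p e to q e.
module GraphEmbedding {n N K s : ℕ}
  {W : Fin N → Set} (W? : Decidable W)
  {Poor : Fin N → Fin N → Set} (poor? : ∀ u v → Dec (Poor u v))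
  (poor-sym : ∀ {u v} → Poor u v → Poor v u)
  (few-poor : ∀ u → W u → # (poor? u) ≤ K)
  (p q : Fin n → Fin n)
  (2n≤s² : 2 * n ≤ s * s) (pool : n + s * K < # W?) where

  Incident : Fin n → Fin n → Set
  Incident x e = p e ≡ x ⊎ q e ≡ x

  incident? : ∀ x e → Dec (Incident x e)
  incident? x e = (p e ≟ᶠ x) ⊎-dec (q e ≟ᶠ x)

  degree : Fin n → ℕ
  degree x = # (incident? x)

  -- Handshake count: an edge is incident to at most two vertices, a loop to only one.
  degree-sum : sum degree ≤ 2 * n
  degree-sum = begin
    sum degree                                ≡⟨ ∑-comm (λ x e → 𝟙 (incident? x e)) ⟩
    sum (λ e → # (λ x → incident? x e))       ≤⟨ sum-mono (λ e → ≤-trans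
      (#-∪ (λ x → p e ≟ᶠ x) (λ x → q e ≟ᶠ x))
      (+-mono-≤ (#-≡ (p e))
                (#-≡ (q e)))) ⟩
    sum {n} (const 2)                         ≡⟨ sum-const n 2 ⟩
    n * 2                                     ≡⟨ *-comm n 2 ⟩
    2 * n                                     ∎
    where open ≤-Reasoning

  Heavy : Fin n → Set
  Heavy x = s < degree x

  heavy? : Decidable Heavy
  heavy? x = s <? degree x

  -- Markov's inequality: a heavy vertex has degree at least `suc s`, and the degrees sum to at most
  -- `s * s`.
  few-heavy : # heavy? ≤ s
  few-heavy = *-cancelʳ-≤ (# heavy?) s (suc s) (begin
    # heavy? * suc s                      ≡⟨ *-distribʳ-sum (suc s) (𝟙 ∘ heavy?) ⟩
    sum (λ x → 𝟙 (heavy? x) * suc s)      ≤⟨ sum-mono (λ x → ≤-trans (𝟙-*-monoʳ (heavy? x) id)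
                                               (≤-trans (*-monoˡ-≤ (degree x) (𝟙≤1 (heavy? x)))
                                                        (≤-reflexive (*-identityˡ _)))) ⟩
    sum degree                            ≤⟨ degree-sum ⟩
    2 * n                                 ≤⟨ 2n≤s² ⟩
    s * s                                 ≤⟨ *-monoʳ-≤ s (n≤1+n s) ⟩
    s * suc s                             ∎)
    where open ≤-Reasoning

  -- Vertices outside xs have arbitrary images in the pool.
  Embeds : List (Fin n) → (Fin n → Fin N) → Set
  Embeds xs f = (∀ x → W (f x)) ×
    (∀ {x y} → x ∈ˡ xs → y ∈ˡ xs → x ≢ y → f x ≢ f y × (Adjacent p q x y → ¬ Poor (f x) (f y)))

  -- Even the empty embedding needs one vertex of the pool as default image; comparing the pool with
  -- an empty predicate produces it.
  nothing-embeds : ∃ (Embeds [])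
  nothing-embeds =
    let w , w∈W , _ = #<#⇒∃ {P = λ _ → ⊥} (λ _ → no id) W?
                        (≤-<-trans (#≡0 {N} {λ _ → ⊥} (λ _ → no id) (λ _ → id)) (≤-<-trans z≤n pool))
    in const w , const w∈W , λ ()

  -- The neighbours of x in xs are listed as h i with i in A.
  extend : ∀ {xs f} x → Embeds xs f → x ∉ˡ xs →
           {A : Fin n → Set} (A? : Decidable A) (h : Fin n → Fin n) → # A? ≤ s →
           (∀ {y} → y ∈ˡ xs → Adjacent p q x y → ∃ λ i → A i × h i ≡ y) →
           ∃ (Embeds (x ∷ xs))
  extend {xs} {f} x (inW , emb) x∉xs {A} A? h A≤s listed = g , g∈W , g-emb
    where
    used? : Decidable λ j → ∃ λ y → y ∈ˡ xs × f y ≡ j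
    used? j = any? λ y → (y ∈ˡ? xs) ×-dec (f y ≟ᶠ j)

    spoilt? : Decidable λ j → ∃ λ i → A i × Poor (f (h i)) j
    spoilt? j = any? λ i → A? i ×-dec poor? (f (h i)) j

    choice : ∃ λ j → W j × ¬ ((∃ λ y → y ∈ˡ xs × f y ≡ j) ⊎ (∃ λ i → A i × Poor (f (h i)) j))
    -- At most `n` places are used, and each of at most `s` listed neighbours spoils at most `K`
    -- more.
    choice = #<#⇒∃ (λ j → used? j ⊎-dec spoilt? j) W? (begin-strict
      # (λ j → used? j ⊎-dec spoilt? j) ≤⟨ #-∪ used? spoilt? ⟩
      # used? + # spoilt?               ≤⟨ +-mono-≤
        (≤-trans (#-⋃ (_∈ˡ? xs) (λ y j → f y ≟ᶠ j) λ y _ →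
                    #-≡ (f y))
                 (≤-trans (≤-reflexive (*-identityʳ _)) (#≤n (_∈ˡ? xs))))
        -- `few-poor` applies even when `h i` is outside `xs`, because default images lie in the
        -- pool too.
        (≤-trans (#-⋃ A? (λ i → poor? (f (h i))) λ i _ → few-poor (f (h i)) (inW (h i)))
                 (*-monoˡ-≤ K A≤s)) ⟩
      n + s * K                         <⟨ pool ⟩
      # W?                              ∎)
      where open ≤-Reasoning

    j = proj₁ choice

    g : Fin n → Fin N
    g = updateAt f x (const j)

    gx : g x ≡ j
    gx = updateAt-updates x f

    g≢x : ∀ {y} → y ≢ x → g y ≡ f y
    g≢x {y} y≢x = updateAt-minimal y x f y≢x

    g∈W : ∀ y → W (g y)
    g∈W y with y ≟ᶠ x
    ... | yes refl = subst W (sym gx) (proj₁ (proj₂ choice))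
    ... | no y≢x   = subst W (sym (g≢x y≢x)) (inW y)

    old≢x : ∀ {y} → y ∈ˡ xs → y ≢ x
    old≢x y∈xs refl = x∉xs y∈xs

    avoids : ∀ {y} → y ∈ˡ xs → f y ≢ j × (Adjacent p q x y → ¬ Poor (f y) j)
    avoids {y} y∈xs = (λ eq → proj₂ (proj₂ choice) (inj₁ (y , y∈xs , eq))) ,
      λ adj poor → let i , a , hi≡y = listed y∈xs adj in
        proj₂ (proj₂ choice) (inj₂ (i , a , subst (λ y → Poor (f y) j) (sym hi≡y) poor))

    g-emb : ∀ {y z} → y ∈ˡ x ∷ xs → z ∈ˡ x ∷ xs → y ≢ z →
            g y ≢ g z × (Adjacent p q y z → ¬ Poor (g y) (g z))
    g-emb (here refl) (here refl) y≢z = contradiction refl y≢z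
    g-emb (here refl) (there z∈)  y≢z rewrite gx | g≢x (old≢x z∈) =
      let ≢j , ¬poor = avoids z∈ in ≢j ∘ sym , λ adj → ¬poor adj ∘ poor-sym
    g-emb (there y∈)  (here refl) y≢z rewrite gx | g≢x (old≢x y∈) =
      let ≢j , ¬poor = avoids y∈ in ≢j , ¬poor ∘ Adjacent-sym p q
    g-emb (there y∈)  (there z∈)  y≢z rewrite g≢x (old≢x y∈) | g≢x (old≢x z∈) = emb y∈ z∈ y≢z

  embeds-∷ : ∀ {xs f x} → x ∈ˡ xs → Embeds xs f → Embeds (x ∷ xs) f
  embeds-∷ x∈xs (inW , emb) = inW , λ y∈ z∈ → emb (∈-shrink x∈xs y∈) (∈-shrink x∈xs z∈)

  -- As long as only heavy vertices are placed, the heavy vertices themselves, with `h` the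
  -- identity, list all possible neighbours, and there are at most `s` of them.
  embed-heavy : ∀ xs → (∀ {x} → x ∈ˡ xs → Heavy x) → ∃ (Embeds xs)
  embed-heavy []       _     = nothing-embeds
  embed-heavy (x ∷ xs) heavy with embed-heavy xs (heavy ∘ there) | x ∈ˡ? xs
  ... | f , emb | yes x∈xs = f , embeds-∷ x∈xs emb
  ... | f , emb | no x∉xs  =
    extend x emb x∉xs heavy? id few-heavy λ {y} y∈ _ → y , heavy (there y∈) , refl

  heavies : List (Fin n)
  heavies = filter heavy? (allFin n)

  -- Meaningful only for edges incident to `x`; for any other edge the value is a junk default.
  other-end : Fin n → Fin n → Fin n
  other-end x e = if does (p e ≟ᶠ x) then q e else p e

  other-end-adjacent : ∀ {x y} → Adjacent p q x y → ∃ λ e → Incident x e × other-end x e ≡ y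
  other-end-adjacent {x} {y} (e , inj₁ (pe , qe)) = e , inj₁ pe , eq
    where
    eq : other-end x e ≡ y
    eq with p e ≟ᶠ x
    ... | yes _  = qe
    ... | no ¬pe = contradiction pe ¬pe
  other-end-adjacent {x} {y} (e , inj₂ (pe , qe)) = e , inj₂ qe , eq
    where
    eq : other-end x e ≡ y
    eq with p e ≟ᶠ x
    -- Here the edge is a loop, so `x` and `y` coincide.
    ... | yes pe′ = trans (trans qe (sym pe′)) pe
    ... | no _    = pe

  -- The heavy vertices stand at the end of the list and are placed first. A vertex not yet placed
  -- is therefore light, and its at most `s` incident edges list its neighbours.
  embed-light : ∀ xs → ∃ (Embeds (xs ++ heavies))
  embed-light []       = embed-heavy heavies (proj₂ ∘ ∈-filter⁻ heavy? {xs = allFin n})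
  embed-light (x ∷ xs) with embed-light xs | x ∈ˡ? (xs ++ heavies)
  -- Heavy vertices come up again in `allFin n`; they keep their images.
  ... | f , emb | yes x∈ = f , embeds-∷ x∈ emb
  ... | f , emb | no x∉  =
    extend x emb x∉ (incident? x) (other-end x)
      (≮⇒≥ λ heavy → x∉ (∈-++⁺ʳ xs (∈-filter⁺ heavy? (∈-allFin x) heavy)))
      (λ _ → other-end-adjacent)

  embedding : ∃ λ (f : Fin n → Fin N) → ∀ x y → x ≢ y →
              f x ≢ f y × (Adjacent p q x y → ¬ Poor (f x) (f y))
  embedding =
    let f , _ , emb = embed-light (allFin n)
    in f , λ x y → emb (∈-++⁺ˡ (∈-allFin x)) (∈-++⁺ˡ (∈-allFin y))

-- Distinct representatives for the spikes

module Representatives {n N : ℕ} (f : Fin n → Fin N)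
  {S : Fin n → Fin N → Set} (S? : ∀ x → Decidable (S x)) (large : ∀ x → n + n < # (S? x)) where

  Represents : List (Fin n) → (Fin n → Fin N) → Set
  Represents xs g = ∀ {x} → x ∈ˡ xs →
    S x (g x) × (∀ y → g x ≢ f y) × (∀ {y} → y ∈ˡ xs → x ≢ y → g x ≢ g y)

  represent : ∀ xs → ∃ (Represents xs)
  represent []       = f , λ ()
  represent (x ∷ xs) with represent xs | x ∈ˡ? xs
  ... | g , rep | yes x∈ = g , λ y∈ →
    let s , new , distinct = rep (∈-shrink x∈ y∈) in s , new , distinct ∘ ∈-shrink x∈
  ... | g , rep | no x∉ = g′ , rep′
    where
    f-used? : Decidable λ j → ∃ λ y → ⊤ × f y ≡ j
    f-used? j = any? λ y → yes tt ×-dec (f y ≟ᶠ j)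

    g-used? : Decidable λ j → ∃ λ y → y ∈ˡ xs × g y ≡ j
    g-used? j = any? λ y → (y ∈ˡ? xs) ×-dec (g y ≟ᶠ j)

    choice : ∃ λ j → S x j × ¬ ((∃ λ y → ⊤ × f y ≡ j) ⊎ (∃ λ y → y ∈ˡ xs × g y ≡ j))
    -- The images of `f` and the earlier representatives block at most `n` places each, whence the
    -- `n + n` in `large`.
    choice = #<#⇒∃ (λ j → f-used? j ⊎-dec g-used? j) (S? x) (begin-strict
      # (λ j → f-used? j ⊎-dec g-used? j) ≤⟨ #-∪ f-used? g-used? ⟩
      # f-used? + # g-used?               ≤⟨ +-mono-≤
        (≤-trans (#-⋃ {A = const ⊤} (λ _ → yes tt) (λ y j → f y ≟ᶠ j) λ y _ →
                    #-≡ (f y))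
                 (≤-trans (≤-reflexive (*-identityʳ _)) (#≤n {n} {const ⊤} (λ _ → yes tt))))
        (≤-trans (#-⋃ (_∈ˡ? xs) (λ y j → g y ≟ᶠ j) λ y _ →
                    #-≡ (g y))
                 (≤-trans (≤-reflexive (*-identityʳ _)) (#≤n (_∈ˡ? xs)))) ⟩
      n + n                               <⟨ large x ⟩
      # (S? x)                            ∎)
      where open ≤-Reasoning

    j = proj₁ choice
    ¬used = proj₂ (proj₂ choice)

    g′ : Fin n → Fin N
    g′ = updateAt g x (const j)

    g′x : g′ x ≡ j
    g′x = updateAt-updates x g

    g′-old : ∀ {y} → y ∈ˡ xs → g′ y ≡ g y
    g′-old {y} y∈ = updateAt-minimal y x g λ { refl → x∉ y∈ }

    rep′ : Represents (x ∷ xs) g′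
    rep′ (here refl) rewrite g′x = proj₁ (proj₂ choice)
      , (λ y eq → ¬used (inj₁ (y , tt , sym eq)))
      , λ { (here refl) x≢x → contradiction refl x≢x
          ; (there y∈)  _ eq → ¬used (inj₂ (_ , y∈ , sym (trans eq (g′-old y∈)))) }
    rep′ (there y∈) rewrite g′-old y∈ =
      let s , new , distinct = rep y∈ in s , new
      , λ { (here refl) _ eq → ¬used (inj₂ (_ , y∈ , trans eq g′x))
          ; (there z∈)  y≢z eq → distinct z∈ y≢z (trans eq (g′-old z∈)) }

  representatives : ∃ λ (g : Fin n → Fin N) →
    (∀ x → S x (g x)) × (∀ x y → g x ≢ f y) × (∀ x y → x ≢ y → g x ≢ g y)
  representatives =
    let g , rep = represent (allFin n)
    in g , (λ x → proj₁ (rep (∈-allFin x))) , (λ x → proj₁ (proj₂ (rep (∈-allFin x))))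
         , λ x y → proj₂ (proj₂ (rep (∈-allFin x))) (∈-allFin y)

-- Triples and hedgehogs

triple : ∀ {n} → Fin n → Fin n → Fin n → Subset n
triple u v w = ⁅ u ⁆ ∪ (⁅ v ⁆ ∪ ⁅ w ⁆)

∈-triple⁻ : ∀ {n} {u v w x : Fin n} → x ∈ triple u v w → x ≡ u ⊎ x ≡ v ⊎ x ≡ w
∈-triple⁻ {u = u} {v} {w} x∈ with x∈p∪q⁻ ⁅ u ⁆ (⁅ v ⁆ ∪ ⁅ w ⁆) x∈
... | inj₁ x∈u = inj₁ (x∈⁅y⁆⇒x≡y u x∈u)
... | inj₂ x∈vw with x∈p∪q⁻ ⁅ v ⁆ ⁅ w ⁆ x∈vw
...   | inj₁ x∈v = inj₂ (inj₁ (x∈⁅y⁆⇒x≡y v x∈v))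
...   | inj₂ x∈w = inj₂ (inj₂ (x∈⁅y⁆⇒x≡y w x∈w))

∈-triple⁺ : ∀ {n} {u v w x : Fin n} → x ≡ u ⊎ x ≡ v ⊎ x ≡ w → x ∈ triple u v w
∈-triple⁺ (inj₁ refl)        = x∈p∪q⁺ (inj₁ (x∈⁅x⁆ _))
∈-triple⁺ (inj₂ (inj₁ refl)) = x∈p∪q⁺ (inj₂ (x∈p∪q⁺ (inj₁ (x∈⁅x⁆ _))))
∈-triple⁺ (inj₂ (inj₂ refl)) = x∈p∪q⁺ (inj₂ (x∈p∪q⁺ (inj₂ (x∈⁅x⁆ _))))

triple-swapˡ : ∀ {n} (u v w : Fin n) → triple u v w ≡ triple v u w
triple-swapˡ u v w = begin
  ⁅ u ⁆ ∪ (⁅ v ⁆ ∪ ⁅ w ⁆) ≡⟨ ∪-assoc ⁅ u ⁆ ⁅ v ⁆ ⁅ w ⁆ ⟨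
  (⁅ u ⁆ ∪ ⁅ v ⁆) ∪ ⁅ w ⁆ ≡⟨ cong (_∪ ⁅ w ⁆) (∪-comm ⁅ u ⁆ ⁅ v ⁆) ⟩
  (⁅ v ⁆ ∪ ⁅ u ⁆) ∪ ⁅ w ⁆ ≡⟨ ∪-assoc ⁅ v ⁆ ⁅ u ⁆ ⁅ w ⁆ ⟩
  ⁅ v ⁆ ∪ (⁅ u ⁆ ∪ ⁅ w ⁆) ∎
  where open ≡-Reasoning

triple-swapʳ : ∀ {n} (u v w : Fin n) → triple u v w ≡ triple u w v
triple-swapʳ u v w = cong (⁅ u ⁆ ∪_) (∪-comm ⁅ v ⁆ ⁅ w ⁆)

∣⁅x⁆∪p∣ : ∀ {n} {x : Fin n} {p} → x ∉ p → ∣ ⁅ x ⁆ ∪ p ∣ ≡ suc ∣ p ∣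
∣⁅x⁆∪p∣ {x = zero}  {inside ∷ p}  x∉p = contradiction here x∉p
∣⁅x⁆∪p∣ {x = zero}  {outside ∷ p} x∉p = cong (suc ∘ ∣_∣) (∪-identityˡ p)
∣⁅x⁆∪p∣ {x = suc x} {inside ∷ p}  x∉p = cong suc (∣⁅x⁆∪p∣ (x∉p ∘ there))
∣⁅x⁆∪p∣ {x = suc x} {outside ∷ p} x∉p = ∣⁅x⁆∪p∣ (x∉p ∘ there)

∣triple∣≡3 : ∀ {n} {u v w : Fin n} → u ≢ v → u ≢ w → v ≢ w → ∣ triple u v w ∣ ≡ 3
∣triple∣≡3 {u = u} {v} {w} u≢v u≢w v≢w = begin
  ∣ triple u v w ∣          ≡⟨ ∣⁅x⁆∪p∣ (λ u∈ → [ u≢v ∘ x∈⁅y⁆⇒x≡y v , u≢w ∘ x∈⁅y⁆⇒x≡y w ]′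
                                         (x∈p∪q⁻ ⁅ v ⁆ ⁅ w ⁆ u∈)) ⟩
  suc ∣ ⁅ v ⁆ ∪ ⁅ w ⁆ ∣     ≡⟨ cong suc (∣⁅x⁆∪p∣ (v≢w ∘ x∈⁅y⁆⇒x≡y w)) ⟩
  suc (suc ∣ ⁅ w ⁆ ∣)       ≡⟨ cong (2 +_) (∣⁅x⁆∣≡1 w) ⟩
  3                         ∎
  where open ≡-Reasoning

∈-image⁺ : ∀ {n N} (f : Fin n → Fin N) {e x} → x ∈ e → f x ∈ image f e
∈-image⁺ f {e} {x} x∈e = lookup⇒[]= (f x) _ (trans (lookup∘tabulate _ (f x)) found)
  where
  found : does (any? λ i → (i ∈? e) ×-dec (f i ≟ᶠ f x)) ≡ true
  found = dec-true (any? λ i → (i ∈? e) ×-dec (f i ≟ᶠ f x)) (x , x∈e , refl)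

∈-image⁻ : ∀ {n N} (f : Fin n → Fin N) {e j} → j ∈ image f e → ∃ λ i → i ∈ e × f i ≡ j
-- In the case `no` the second term would prove `false ≡ true`, so only `yes` remains.
∈-image⁻ f {e} {j} j∈ with any? (λ i → (i ∈? e) ×-dec (f i ≟ᶠ j))
                         | trans (sym (lookup∘tabulate _ j)) ([]=⇒lookup j∈)
... | yes found | _ = found

image-triple : ∀ {n N} (f : Fin n → Fin N) u v w →
               image f (triple u v w) ≡ triple (f u) (f v) (f w)
image-triple f u v w = ⊆-antisym to from
  where
  to : ∀ {j} → j ∈ image f (triple u v w) → j ∈ triple (f u) (f v) (f w)
  to j∈ with ∈-image⁻ f j∈
  ... | i , i∈ , refl = ∈-triple⁺ (Sum.map (cong f) (Sum.map (cong f) (cong f)) (∈-triple⁻ i∈))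
  from : ∀ {j} → j ∈ triple (f u) (f v) (f w) → j ∈ image f (triple u v w)
  from j∈ with ∈-triple⁻ j∈
  ... | inj₁ refl        = ∈-image⁺ f (∈-triple⁺ (inj₁ refl))
  ... | inj₂ (inj₁ refl) = ∈-image⁺ f (∈-triple⁺ (inj₂ (inj₁ refl)))
  ... | inj₂ (inj₂ refl) = ∈-image⁺ f (∈-triple⁺ (inj₂ (inj₂ refl)))

∣p∣≡0⇒∉ : ∀ {n x} (p : Subset n) → ∣ p ∣ ≡ 0 → x ∉ p
∣p∣≡0⇒∉ (outside ∷ p) eq (there x∈) = ∣p∣≡0⇒∉ p eq x∈

extract : ∀ {n k} (p : Subset n) → ∣ p ∣ ≡ suc k →
          ∃₂ λ x p′ → x ∉ p′ × ∣ p′ ∣ ≡ k × p ≡ ⁅ x ⁆ ∪ p′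
extract (inside ∷ p)  eq = zero , outside ∷ p , (λ ()) , cong pred eq , cong (inside ∷_) (sym (∪-identityˡ p))
extract (outside ∷ p) eq with extract p eq
... | x , p′ , x∉p′ , size , refl = suc x , outside ∷ p′ , (λ { (there x∈) → x∉p′ x∈ }) , size , refl

singleton : ∀ {n} (p : Subset n) → ∣ p ∣ ≡ 1 → ∃ λ x → x ∈ p × (∀ {y} → y ∈ p → y ≡ x)
singleton p eq with extract p eq
... | x , p′ , _ , size , refl = x , x∈p∪q⁺ (inj₁ (x∈⁅x⁆ x)) , λ y∈ →
  [ x∈⁅y⁆⇒x≡y x , (λ y∈p′ → contradiction y∈p′ (∣p∣≡0⇒∉ p′ size)) ]′ (x∈p∪q⁻ ⁅ x ⁆ p′ y∈)

doubleton : ∀ {n} (p : Subset n) → ∣ p ∣ ≡ 2 →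
            ∃₂ λ a b → a ≢ b × a ∈ p × b ∈ p × (∀ {y} → y ∈ p → y ≡ a ⊎ y ≡ b)
doubleton p eq with extract p eq
... | a , p′ , a∉p′ , size , refl with singleton p′ size
...   | b , b∈p′ , unique = a , b , (λ { refl → a∉p′ b∈p′ })
  , x∈p∪q⁺ (inj₁ (x∈⁅x⁆ a)) , x∈p∪q⁺ (inj₂ b∈p′)
  , λ y∈ → Sum.map (x∈⁅y⁆⇒x≡y a) unique (x∈p∪q⁻ ⁅ a ⁆ p′ y∈)

splice : ∀ {n} {A : Set} → Subset n → (f g : Fin n → A) → Fin n → A
splice p f g x = if does (x ∈? p) then f x else g x

splice-∈ : ∀ {n} {A : Set} {p : Subset n} (f g : Fin n → A) {x} → x ∈ p → splice p f g x ≡ f x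
splice-∈ {p = p} f g {x} x∈ rewrite dec-true (x ∈? p) x∈ = refl

splice-∉ : ∀ {n} {A : Set} {p : Subset n} (f g : Fin n → A) {x} → x ∉ p → splice p f g x ≡ g x
splice-∉ {p = p} f g {x} x∉ rewrite dec-false (x ∈? p) x∉ = refl

splice-injective : ∀ {n} {A : Set} (p : Subset n) (f g : Fin n → A) →
  (∀ x y → x ≢ y → f x ≢ f y) → (∀ x y → x ≢ y → g x ≢ g y) → (∀ x y → g x ≢ f y) →
  ∀ {x y} → splice p f g x ≡ splice p f g y → x ≡ y
splice-injective p f g f≢ g≢ g≢f {x} {y} eq = decidable-stable (x ≟ᶠ y) λ x≢y → distinct x≢y eq
  where
  distinct : x ≢ y → splice p f g x ≢ splice p f g y
  distinct x≢y with x ∈? p | y ∈? p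
  ... | yes _ | yes _ = f≢ x y x≢y
  ... | yes _ | no _  = g≢f y x ∘ sym
  ... | no _  | yes _ = g≢f x y
  ... | no _  | no _  = g≢ x y x≢y

-- The spike stands last in the triple because a codegree counts the choices of the third vertex.
-- Quantifying over all edges through `x` lets an edge be recognised from its spike alone.
SpikeOn : ∀ {n} → 3-Graph n → Subset n → (x a b : Fin n) → Set
SpikeOn G body x a b = a ≢ b × a ∈ body × b ∈ body × (∀ e → Edge G e → x ∈ e → e ≡ triple a b x)

-- The edge through `x` has just one vertex outside the body, which must be `x`; its two body
-- vertices are the ends, and uniqueness identifies every edge through `x` with it.
spike-ends : ∀ {n} {G : 3-Graph n} {body} → IsHedgehogWithBody G body →
             ∀ x → x ∉ body → ∃₂ (SpikeOn G body x)
spike-ends {G = G} {body} hedgehog x x∉body = ends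
  where
  open IsHedgehogWithBody hedgehog
  ends : ∃₂ (SpikeOn G body x)
  ends with unique-edge x (x∉p⇒x∈∁p x∉body)
  ... | e , (e∈G , x∈e) , unique with doubleton (e ∩ body) (two-body e e∈G) | singleton (e ∩ ∁ body) (one-spike e e∈G)
  ...   | a , b , a≢b , a∈ , b∈ , only-ab | x′ , _ , only-x =
    a , b , a≢b , proj₂ (x∈p∩q⁻ e body a∈) , proj₂ (x∈p∩q⁻ e body b∈) , λ e′ e′∈G x∈e′ →
      trans (sym (unique (e′∈G , x∈e′))) (⊆-antisym to from)
    where
    to : ∀ {y} → y ∈ e → y ∈ triple a b x
    to {y} y∈e with y ∈? body
    ... | yes y∈body = ∈-triple⁺ ([ inj₁ , inj₂ ∘ inj₁ ]′ (only-ab (x∈p∩q⁺ (y∈e , y∈body))))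
    ... | no y∉body  = ∈-triple⁺ (inj₂ (inj₂ (trans (only-x (x∈p∩q⁺ (y∈e , x∉p⇒x∈∁p y∉body)))
                                 (sym (only-x (x∈p∩q⁺ (x∈e , x∉p⇒x∈∁p x∉body)))))))
    from : ∀ {y} → y ∈ triple a b x → y ∈ e
    from y∈ with ∈-triple⁻ y∈
    ... | inj₁ refl        = proj₁ (x∈p∩q⁻ e body a∈)
    ... | inj₂ (inj₁ refl) = proj₁ (x∈p∩q⁻ e body b∈)
    ... | inj₂ (inj₂ refl) = x∈e

-- Codegrees, poor pairs and copies of hedgehogs

codegree : ∀ {N} → 3-Graph N → Fin N → Fin N → ℕ
codegree K u v = # λ w → edge? K (triple u v w)

codegree-sym : ∀ {N} (K : 3-Graph N) u v → codegree K u v ≤ codegree K v u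
codegree-sym K u v = #-mono (λ w → edge? K (triple u v w)) (λ w → edge? K (triple v u w))
  λ w → subst (Edge K) (triple-swapˡ u v w)

poor? : ∀ {N} (K : 3-Graph N) (m : ℕ) → ∀ u v → Dec (codegree K u v ≤ m)
poor? K m u v = codegree K u v ≤? m

poor-degree : ∀ {N} → 3-Graph N → ℕ → Fin N → ℕ
poor-degree K m u = # (poor? K m u)

-- The body embedding sends the ends of each spike to a pair of codegree above `n + n`, which leaves
-- room for distinct third vertices off the image of `f`. Both `f` and `g` are total; `splice` keeps
-- `f` on the body and `g` on the spikes.
hedgehog-copy : ∀ {n N} D s (H : 3-Graph n) (K : 3-Graph N) → IsHedgehog H →
  2 * n ≤ s * s → n + n + s * D < # (λ u → poor-degree K (n + n) u ≤? D) → ContainsCopy K H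
hedgehog-copy {n} {N} D s H K (body , hedgehog) 2n≤s² pool =
  F , splice-injective body f g (λ x y → proj₁ ∘ proj₂ embedding x y)
        (proj₂ (proj₂ (proj₂ representatives))) (proj₁ (proj₂ (proj₂ representatives)))
    , F-edges
  where
  open IsHedgehogWithBody hedgehog

  ends : ∀ x → ∃₂ λ a b → x ∉ body → SpikeOn H body x a b
  ends x with x ∈? body
  -- The graph has one edge per vertex, so a body vertex needs a default; a loop is harmless, since
  -- only distinct vertices have to avoid poor pairs.
  ... | yes x∈ = x , x , contradiction x∈
  ... | no x∉  = let a , b , spike = spike-ends hedgehog x x∉ in a , b , const spike

  p q : Fin n → Fin n
  p x = proj₁ (ends x)
  q x = proj₁ (proj₂ (ends x))

  spike : ∀ x → x ∉ body → SpikeOn H body x (p x) (q x)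
  spike x = proj₂ (proj₂ (ends x))

  -- The pool is defined by the bound `D` on the poor degree, so `few-poor` is the identity.
  open GraphEmbedding {K = D} {s = s} (λ u → poor-degree K (n + n) u ≤? D) (poor? K (n + n))
    (λ {u} {v} → ≤-trans (codegree-sym K v u)) (λ _ → id) p q 2n≤s²
    (≤-<-trans (+-monoˡ-≤ (s * D) (m≤m+n n n)) pool)

  f : Fin n → Fin N
  f = proj₁ embedding

  -- Vacuous for a body vertex, whose representative is discarded by `splice`.
  S : Fin n → Fin N → Set
  S x j = x ∉ body → Edge K (triple (f (p x)) (f (q x)) j)

  S? : ∀ x → Decidable (S x)
  S? x j = ¬? (x ∈? body) →-dec edge? K (triple (f (p x)) (f (q x)) j)

  room : ∀ x → n + n < # (S? x)
  -- For a body vertex `S x` is everything, so the size of the pool suffices; for a spike, the ends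
  -- form a pair that is not poor.
  room x = [ (λ x∈ → <-≤-trans (≤-<-trans (m≤m+n _ _) pool)
                (#-mono (λ u → poor-degree K (n + n) u ≤? D) (S? x) λ _ _ x∉ → contradiction x∈ x∉))
           , (λ x∉ → <-≤-trans (≰⇒> (rich x∉))
                (#-mono (λ j → edge? K (triple (f (p x)) (f (q x)) j)) (S? x) λ _ → const)) ]′
           (toSum (x ∈? body))
    where
    rich : x ∉ body → ¬ codegree K (f (p x)) (f (q x)) ≤ n + n
    rich x∉ = proj₂ (proj₂ embedding (p x) (q x) (proj₁ (spike x x∉))) (x , inj₁ (refl , refl))

  open Representatives f S? room

  g : Fin n → Fin N
  g = proj₁ representatives

  F : Fin n → Fin N
  F = splice body f g

  F-edges : ∀ e → Edge H e → Edge K (image F e)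
  F-edges e e∈H = subst (Edge K) (sym eq) (proj₁ (proj₂ representatives) x x∉)
    where
    the-spike : ∃ λ x → x ∈ e ∩ ∁ body × (∀ {y} → y ∈ e ∩ ∁ body → y ≡ x)
    the-spike = singleton (e ∩ ∁ body) (one-spike e e∈H)
    x : Fin n
    x = proj₁ the-spike
    x∈e : x ∈ e
    x∈e = proj₁ (x∈p∩q⁻ e (∁ body) (proj₁ (proj₂ the-spike)))
    x∉ : x ∉ body
    x∉ = x∈∁p⇒x∉p (proj₂ (x∈p∩q⁻ e (∁ body) (proj₁ (proj₂ the-spike))))
    eq : image F e ≡ triple (f (p x)) (f (q x)) (g x)
    eq = let _ , p∈ , q∈ , is-triple = spike x x∉ in begin
      image F e                          ≡⟨ cong (image F) (is-triple e e∈H x∈e) ⟩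
      image F (triple (p x) (q x) x)     ≡⟨ image-triple F (p x) (q x) x ⟩
      triple (F (p x)) (F (q x)) (F x)   ≡⟨ cong₂ (λ u v → triple u v (F x)) (splice-∈ f g p∈) (splice-∈ f g q∈) ⟩
      triple (f (p x)) (f (q x)) (F x)   ≡⟨ cong (triple (f (p x)) (f (q x))) (splice-∉ f g x∉) ⟩
      triple (f (p x)) (f (q x)) (g x)   ∎
      where open ≡-Reasoning

-- A colour with many vertices of small poor degree

colour-cover : ∀ {N} (χ : Colouring N) {u v w} → u ≢ v → u ≢ w → v ≢ w →
  Edge (colourClass χ blue) (triple u v w) ⊎ Edge (colourClass χ red) (triple u v w)
colour-cover χ {u} {v} {w} u≢v u≢w v≢w with χ (triple u v w) (∣triple∣≡3 u≢v u≢w v≢w) in eq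
... | blue = inj₁ (∣triple∣≡3 u≢v u≢w v≢w , eq)
... | red  = inj₂ (∣triple∣≡3 u≢v u≢w v≢w , eq)

-- A pair of a blue-poor partner `v` and a red-poor partner `w` of `u` is charged to `v` if the
-- triple is blue and to `w` if it is red; poverty allows at most `m` such charges. Where vertices
-- coincide there is no triple: `v ≡ w` and `u ≡ w` are charged to `v`, and `u ≡ v` to `w`, whence
-- `m + 2`.
poor-degree-small : ∀ {N} (χ : Colouring N) m u →
  poor-degree (colourClass χ blue) m u ≤ 2 * (m + 2) ⊎ poor-degree (colourClass χ red) m u ≤ 2 * (m + 2)
poor-degree-small {N} χ m u = product≤⇒small _ _ (m + 2)
  (double-count (poor? Blue m u) (poor? Red m u) α? γ? rows cols cover)
  where
  Blue Red : 3-Graph N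
  Blue = colourClass χ blue
  Red  = colourClass χ red

  α? : ∀ v w → Dec (Edge Blue (triple u v w) ⊎ v ≡ w ⊎ u ≡ w)
  α? v w = edge? Blue (triple u v w) ⊎-dec ((v ≟ᶠ w) ⊎-dec (u ≟ᶠ w))

  γ? : ∀ v w → Dec (Edge Red (triple u v w) ⊎ u ≡ v)
  γ? v w = edge? Red (triple u v w) ⊎-dec (u ≟ᶠ v)

  rows : ∀ v → codegree Blue u v ≤ m → # (α? v) ≤ m + 2
  rows v poor = ≤-trans (#-∪ (λ w → edge? Blue (triple u v w)) (λ w → (v ≟ᶠ w) ⊎-dec (u ≟ᶠ w)))
    (+-mono-≤ poor (≤-trans (#-∪ (v ≟ᶠ_) (u ≟ᶠ_))
      (+-mono-≤ (#-≡ v)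
                (#-≡ u))))

  cols : ∀ w → codegree Red u w ≤ m → # (λ v → γ? v w) ≤ m + 2
  cols w poor = ≤-trans (#-∪ (λ v → edge? Red (triple u v w)) (u ≟ᶠ_))
    -- A column varies the middle vertex, so the last two are swapped to reach the codegree of `u`
    -- and `w`.
    (+-mono-≤ (≤-trans (#-mono (λ v → edge? Red (triple u v w)) (λ v → edge? Red (triple u w v))
                          λ v → subst (Edge Red) (triple-swapʳ u v w)) poor)
              (≤-trans (#-≡ u) (n≤1+n 1)))

  cover : ∀ v w → codegree Blue u v ≤ m → codegree Red u w ≤ m →
          (Edge Blue (triple u v w) ⊎ v ≡ w ⊎ u ≡ w) ⊎ (Edge Red (triple u v w) ⊎ u ≡ v)
  cover v w _ _ with u ≟ᶠ v | u ≟ᶠ w | v ≟ᶠ w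
  ... | yes u≡v | _       | _       = inj₂ (inj₂ u≡v)
  ... | no _    | yes u≡w | _       = inj₁ (inj₂ (inj₂ u≡w))
  ... | no _    | no _    | yes v≡w = inj₁ (inj₂ (inj₁ v≡w))
  ... | no u≢v  | no u≢w  | no v≢w  = Sum.map inj₁ inj₁ (colour-cover χ u≢v u≢w v≢w)

half : ∀ m a b → 2 * m < a + b → m < a ⊎ m < b
half m a b 2m<a+b with m <? a | m <? b
... | yes m<a | _       = inj₁ m<a
... | no _    | yes m<b = inj₂ m<b
... | no m≮a  | no m≮b  = contradiction 2m<a+b (≤⇒≯ (≤-trans (+-mono-≤ (≮⇒≥ m≮a) (≮⇒≥ m≮b))
                            (≤-reflexive (cong (m +_) (sym (+-identityʳ m))))))

-- Each of the `suc (2 * M)` vertices has poor degree at most `D` in some colour, so more than `M`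
-- of them share a colour, and `M` is the pool size that `hedgehog-copy` asks to exceed.
hedgehogs-arrow : ∀ {n} s (H H′ : 3-Graph n) → IsHedgehog H → IsHedgehog H′ → 2 * n ≤ s * s →
  Arrows (suc (2 * (n + n + s * (2 * (n + n + 2))))) H H′
hedgehogs-arrow {n} s H H′ hedgehog hedgehog′ 2n≤s² χ =
  [ inj₁ ∘ hedgehog-copy D s H (colourClass χ blue) hedgehog 2n≤s²
  , inj₂ ∘ hedgehog-copy D s H′ (colourClass χ red) hedgehog′ 2n≤s² ]′ (half M _ _ cover)
  where
  D M N : ℕ
  D = 2 * (n + n + 2)
  M = n + n + s * D
  N = suc (2 * M)

  small? : (c : Colour) → Decidable λ u → poor-degree (colourClass χ c) (n + n) u ≤ D
  small? c u = poor-degree (colourClass χ c) (n + n) u ≤? D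

  cover : N ≤ # (small? blue) + # (small? red)
  cover = begin
    N                                          ≡⟨ *-identityʳ N ⟨
    N * 1                                      ≡⟨ sum-const N 1 ⟨
    sum {N} (const 1)                          ≤⟨ sum-mono (λ u → 𝟙-intro (small? blue u ⊎-dec small? red u)
                                                    (poor-degree-small χ (n + n) u)) ⟩
    # (λ u → small? blue u ⊎-dec small? red u) ≤⟨ #-∪ (small? blue) (small? red) ⟩
    # (small? blue) + # (small? red)           ∎
    where open ≤-Reasoning

-- Decidability of the arrow relation

-- The Ramsey number is found as the least arrowing `N`, so `Arrows` has to be decided, by
-- exhaustive search over colourings and maps.
Searchable : Set → Set₁
Searchable A = ∀ {P : A → Set} → Decidable P → Dec (∃ P)

search-× : ∀ {A B} → Searchable A → Searchable B → Searchable (A × B)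
search-× searchA searchB P? =
  map′ (λ (a , b , h) → (a , b) , h) (λ ((a , b) , h) → a , b , h)
       (searchA λ a → searchB λ b → P? (a , b))

search-Vec : ∀ {A} → Searchable A → ∀ n → Searchable (Vec A n)
search-Vec search zero    P? = map′ ([] ,_) (λ { ([] , h) → h }) (P? [])
search-Vec search (suc n) P? =
  map′ (λ ((a , v) , h) → a ∷ v , h) (λ { (a ∷ v , h) → (a , v) , h })
       (search-× search (search-Vec search n) λ (a , v) → P? (a ∷ v))

search-Colour : Searchable Colour
search-Colour P? = map′ [ (red ,_) , (blue ,_) ]′ (λ { (red , h) → inj₁ h ; (blue , h) → inj₂ h })
                        (P? red ⊎-dec P? blue)

-- A binary tree with one leaf for each subset: as first-order data, colourings can be searched
-- without extensionality of functions.
Table : ℕ → Set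
Table zero    = Colour
Table (suc n) = Table n × Table n

search-Table : ∀ n → Searchable (Table n)
search-Table zero    = search-Colour
search-Table (suc n) = search-× (search-Table n) (search-Table n)

entry : ∀ {n} → Table n → Subset n → Colour
entry c       []            = c
entry (l , r) (inside ∷ e)  = entry l e
entry (l , r) (outside ∷ e) = entry r e

table : ∀ {n} → (Subset n → Colour) → Table n
table {zero}  c = c []
table {suc n} c = table (c ∘ (inside ∷_)) , table (c ∘ (outside ∷_))

entry-table : ∀ {n} (c : Subset n → Colour) e → entry (table c) e ≡ c e
entry-table c []            = refl
entry-table c (inside ∷ e)  = entry-table (c ∘ (inside ∷_)) e
entry-table c (outside ∷ e) = entry-table (c ∘ (outside ∷_)) e

-- A map read back from its vector agrees with the original only pointwise.
image-cong : ∀ {n N} {f g : Fin n → Fin N} → (∀ i → f i ≡ g i) → ∀ e → image f e ≡ image g e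
image-cong {f = f} {g} f≗g e = ⊆-antisym (sub f g f≗g) (sub g f (sym ∘ f≗g))
  where
  sub : ∀ h k → (∀ i → h i ≡ k i) → ∀ {j} → j ∈ image h e → j ∈ image k e
  sub h k h≗k j∈ with ∈-image⁻ h j∈
  ... | i , i∈ , refl = subst (_∈ image k e) (sym (h≗k i)) (∈-image⁺ k i∈)

-- Maps are enumerated as vectors. The edge condition becomes the absence of a bad edge, the form
-- that a search over subsets decides; decidability of `Edge K` removes the double negation.
containsCopy? : ∀ {n N} (K : 3-Graph N) (G : 3-Graph n) → Dec (ContainsCopy K G)
containsCopy? {n} {N} K G = map′ to from (search-Vec any? n λ v → injective? v ×-dec edges? v)
  where
  Inj Edges : Vec (Fin N) n → Set
  Inj v   = ∀ x y → lookup v x ≡ lookup v y → x ≡ y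
  Edges v = ¬ (∃ λ e → Edge G e × ¬ Edge K (image (lookup v) e))

  injective? : Decidable Inj
  injective? v = all? λ x → all? λ y → (lookup v x ≟ᶠ lookup v y) →-dec (x ≟ᶠ y)

  edges? : Decidable Edges
  edges? v = ¬? (anySubset? λ e → edge? G e ×-dec ¬? (edge? K (image (lookup v) e)))

  to : (∃ λ v → Inj v × Edges v) → ContainsCopy K G
  to (v , inj , edges) = lookup v , (λ {x} {y} → inj x y) , λ e e∈G →
    decidable-stable (edge? K _) λ e∉K → edges (e , e∈G , e∉K)

  from : ContainsCopy K G → ∃ λ v → Inj v × Edges v
  from (f , inj , edges) = tabulate f
    , (λ x y eq → inj (trans (sym (lookup∘tabulate f x)) (trans eq (lookup∘tabulate f y))))
    , λ (e , e∈G , e∉K) → e∉K (subst (Edge K) (sym (image-cong (lookup∘tabulate f) e)) (edges e e∈G))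

containsCopy-mono : ∀ {n N} (K L : 3-Graph N) (G : 3-Graph n) → (∀ e → Edge K e → Edge L e) →
                    ContainsCopy K G → ContainsCopy L G
containsCopy-mono K L G K⊆L (f , inj , edges) = f , inj , λ e → K⊆L _ ∘ edges e

arrows? : ∀ {m n} (G : 3-Graph m) (H : 3-Graph n) N → Dec (Arrows N G H)
arrows? G H N = map′ to from (¬? (search-Table N λ t → ¬? (holds? (colouring t))))
  where
  Holds : Colouring N → Set
  Holds χ = ContainsCopy (colourClass χ blue) G ⊎ ContainsCopy (colourClass χ red) H

  holds? : Decidable Holds
  holds? χ = containsCopy? (colourClass χ blue) G ⊎-dec containsCopy? (colourClass χ red) H

  colouring : Table N → Colouring N
  colouring t e _ = entry t e

  -- Subsets that are not triples get a junk colour.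
  total : Colouring N → Subset N → Colour
  total χ e with ∣ e ∣ ≟ 3
  ... | yes p = χ e p
  ... | no _  = red

  total-triple : ∀ χ e p → total χ e ≡ χ e p
  total-triple χ e p with ∣ e ∣ ≟ 3
  -- The colour of `e` does not depend on the proof that `e` has three elements.
  ... | yes p′ = cong (χ e) (≡-irrelevant p′ p)
  ... | no ¬p  = contradiction p ¬p

  to : ¬ (∃ λ t → ¬ Holds (colouring t)) → Arrows N G H
  to none χ = Sum.map
    (containsCopy-mono (colourClass (colouring t) blue) (colourClass χ blue) G (same blue))
    (containsCopy-mono (colourClass (colouring t) red) (colourClass χ red) H (same red))
    (decidable-stable (holds? (colouring t)) λ fails → none (t , fails))
    where
    t : Table N
    t = table (total χ)
    same : ∀ c e → Edge (colourClass (colouring t) c) e → Edge (colourClass χ c) e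
    same c e (p , eq) = p , trans (sym (trans (entry-table (total χ) e) (total-triple χ e p))) eq

  from : Arrows N G H → ¬ (∃ λ t → ¬ Holds (colouring t))
  from arrows (t , fails) = fails (arrows (colouring t))

-- Least witnesses, square roots and the final estimate

least : ∀ {P : ℕ → Set} → Decidable P → ∀ n → P n → ∃ λ m → (P m × (∀ k → k < m → ¬ P k)) × m ≤ n
least P? zero    p = zero , (p , λ _ ()) , z≤n
least P? (suc n) p with P? zero
... | yes p₀ = zero , (p₀ , λ _ ()) , z≤n
... | no ¬p₀ with least (P? ∘ suc) n p
...   | m , (pₘ , below) , m≤n = suc m , (pₘ , λ { zero _ → ¬p₀ ; (suc k) (s≤s k<m) → below k k<m }) , s≤s m≤n

sqrt : ∀ n → ∃ λ r → r * r ≤ n × n < suc r * suc r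
sqrt zero    = 0 , z≤n , s≤s z≤n
sqrt (suc n) with sqrt n
... | r , r²≤n , n<r⁺² with suc n <? suc r * suc r
...   | yes below = r , m≤n⇒m≤1+n r²≤n , below
-- `n < suc r * suc r` unfolds to `suc n ≤ suc r * suc r`, which is below the next square.
...   | no ≮      = suc r , ≮⇒≥ ≮ , ≤-<-trans n<r⁺² (*-mono-< {suc r} {suc (suc r)} {suc r} {suc (suc r)} (n<1+n (suc r)) (n<1+n (suc r)))

-- The left side expands to `1 + 4 * n + 8 * (n * s) + 8 * s`; as `n` and `s` are positive, each
-- monomial is at most `n * s`, and the coefficients add up to 21.
bound : ∀ n s → 1 ≤ n → 1 ≤ s → suc (2 * (n + n + s * (2 * (n + n + 2)))) ≤ 21 * (n * s)
bound n s 1≤n 1≤s = begin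
  suc (2 * (n + n + s * (2 * (n + n + 2)))) ≡⟨ solve 2 (λ n s → con 1 :+ con 2 :* (n :+ n :+ s :* (con 2 :* (n :+ n :+ con 2)))
                                                 := con 1 :* con 1 :+ con 4 :* (n :* con 1) :+ con 8 :* (n :* s) :+ con 8 :* (con 1 :* s)) refl n s ⟩
  1 * 1 + 4 * (n * 1) + 8 * (n * s) + 8 * (1 * s)
    ≤⟨ +-mono-≤ (+-monoˡ-≤ (8 * (n * s)) (+-mono-≤ (*-mono-≤ 1≤n 1≤s) (*-monoʳ-≤ 4 (*-monoʳ-≤ n 1≤s))))
                (*-monoʳ-≤ 8 (*-monoˡ-≤ s 1≤n)) ⟩
  n * s + 4 * (n * s) + 8 * (n * s) + 8 * (n * s)
    ≡⟨ solve 1 (λ x → x :+ con 4 :* x :+ con 8 :* x :+ con 8 :* x := con 21 :* x) refl (n * s) ⟩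
  21 * (n * s) ∎
  where
  open ≤-Reasoning
  open +-*-Solver

theorem1p2 : ∃[ C ] (0 < C × ∃[ n₀ ] (∀ (n : ℕ) → n₀ ≤ n →
    (H H′ : 3-Graph n) → IsHedgehog H → IsHedgehog H′ →
    ∃[ R ] (IsRamseyNumber H H′ R × R ^ 2 ≤ C ^ 2 * n ^ 3)))
-- The inequality is squared to stay in `ℕ`. `N` is at most `21 * (n * s)` and `s * s` at most
-- `16 * n`, so `C` is `21 * 4`; both estimates require `n` to be positive.
theorem1p2 = 84 , s≤s z≤n , 1 , λ n 1≤n H H′ hedgehog hedgehog′ →
  let r , r²≤n , n<r⁺² = sqrt n
      -- The factor 2 makes `s * s` equal to `4 * (suc r * suc r)`, hence at least `2 * n`.
      s = 2 * suc r
      N = suc (2 * (n + n + s * (2 * (n + n + 2))))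
      R , ramsey , R≤N = least (arrows? H H′) N
                           (hedgehogs-arrow s H H′ hedgehog hedgehog′ (2n≤s² n r n<r⁺²))
  in R , ramsey , (begin
       R ^ 2               ≤⟨ ^-monoˡ-≤ 2 R≤N ⟩
       N ^ 2               ≤⟨ ^-monoˡ-≤ 2 (bound n s 1≤n (s≤s z≤n)) ⟩
       (21 * (n * s)) ^ 2  ≡⟨ solve 2 (λ n s → (con 21 :* (n :* s)) :^ 2 := con 441 :* (n :* n) :* (s :* s)) refl n s ⟩
       441 * (n * n) * (s * s)   ≤⟨ *-monoʳ-≤ (441 * (n * n)) (s²≤16n n r 1≤n r²≤n n<r⁺²) ⟩
       441 * (n * n) * (16 * n)  ≡⟨ solve 1 (λ n → con 441 :* (n :* n) :* (con 16 :* n) := con 7056 :* n :^ 3) refl n ⟩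
       84 ^ 2 * n ^ 3      ∎)
  where
  open ≤-Reasoning
  open +-*-Solver

  2n≤s² : ∀ n r → n < suc r * suc r → 2 * n ≤ (2 * suc r) * (2 * suc r)
  2n≤s² n r n< = begin
    2 * n                         ≤⟨ *-mono-≤ {2} {4} (s≤s (s≤s z≤n)) (<⇒≤ n<) ⟩
    4 * (suc r * suc r)           ≡⟨ solve 1 (λ t → con 4 :* (t :* t) := (con 2 :* t) :* (con 2 :* t)) refl (suc r) ⟩
    (2 * suc r) * (2 * suc r)     ∎

  s²≤16n : ∀ n r → 1 ≤ n → r * r ≤ n → n < suc r * suc r → (2 * suc r) * (2 * suc r) ≤ 16 * n
  -- `r` vanishes only when `n` is 0; otherwise `suc r ≤ 2 * r`, which bounds `s` by `4 * r`.
  s²≤16n n zero    1≤n _    n<1 = contradiction n<1 (≤⇒≯ 1≤n)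
  s²≤16n n r@(suc r′) _ r²≤n _  = begin
    (2 * suc r) * (2 * suc r)     ≤⟨ *-mono-≤ 2r⁺≤4r 2r⁺≤4r ⟩
    (4 * r) * (4 * r)             ≡⟨ solve 1 (λ t → (con 4 :* t) :* (con 4 :* t) := con 16 :* (t :* t)) refl r ⟩
    16 * (r * r)                  ≤⟨ *-monoʳ-≤ 16 r²≤n ⟩
    16 * n                        ∎
    where
    2r⁺≤4r : 2 * suc r ≤ 4 * r
    2r⁺≤4r = begin
      2 * suc r     ≤⟨ *-monoʳ-≤ 2 (s≤s (m≤n+m r r′)) ⟩
      2 * (r + r)   ≡⟨ solve 1 (λ t → con 2 :* (t :+ t) := con 4 :* t) refl r ⟩
      4 * r         ∎
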